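{- There exists a function $h(k,\Delta)$ with $h(k,\Delta)=\Theta\big((\Delta-1)^{k/12}\big)$ as $k\to\infty$ such that for all integers $\Delta$ and $k$, only finitely many (finite, simple, connected) graphs $G$ of maximum degree $\Delta$ satisfy $g_k(G)<h(k,\Delta)$.
   Context: For integers $k\geqslant 0$ and $\Delta$, let $f(k,\Delta)=\Delta\sum_{i=0}^{k-1}(\Delta-1)^i$ (the number of non-root nodes of a $\Delta$-ary tree of height $k$). For a graph $G$, its $k$-th power $G^k$ is the graph on $V(G)$ in which two distinct vertices are adjacent iff their distance in $G$ is at most $k$. $\chi$ denotes the chromatic number and $\Delta(G)$ the maximum degree of $G$. The $k$-gap of $G$ is $g_k(G)=f(k,\Delta(G))+1-\chi(G^k)$. -}

module Defs where

open import Data.Fin.Base using (Fin; finToFun; funToFin)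
open import Data.Fin.Properties using (any?; all?; finToFun-funToFin) renaming (_≟_ to _≟ᶠ_)
open import Data.Integer.Base as ℤ using (ℤ; +_; 0ℤ; 1ℤ)
open import Data.List.Base using (List; length; filter; map; foldr; allFin; applyUpTo)
open import Data.List.Extrema.Nat using (max)
open import Data.List.Relation.Unary.Any using (Any)
open import Data.Nat.Base as ℕ using (ℕ; zero; suc; _≤_; _<_; s≤s; s≤s⁻¹; NonZero)
open import Data.Nat.Induction using (<-rec)
open import Data.Nat.Properties using (allUpTo?; anyUpTo?; ≮⇒≥; <⇒≱)
open import Data.Product.Base using (∃; _×_; _,_; proj₁; proj₂)
open import Data.Rational.Base as ℚ using (ℚ; 0ℚ; _/_)
open import Function.Base using (id; _∘_)
open import Function.Bundles using (_↔_; _⇔_; Inverse)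
open import Level using (0ℓ)
open import Relation.Binary.Core using (Rel)
open import Relation.Binary.Definitions using (Symmetric)
open import Relation.Binary.PropositionalEquality using (_≡_; _≢_; refl; sym; subst; subst₂)
open import Relation.Nullary using (¬_; Dec; yes; no)
open import Relation.Nullary.Decidable using (map′; _×-dec_; _→-dec_; ¬?)
open import Relation.Unary using (Pred; Decidable)
import Algebra.Definitions.RawSemiring as RawSemiringDefs

open RawSemiringDefs ℚ.+-*-rawSemiring using () renaming (_^_ to _^ℚ_) public

IsLeast : Pred ℕ 0ℓ → Pred ℕ 0ℓ
IsLeast P n = P n × (∀ m → P m → n ≤ m)

module _ {P : Pred ℕ 0ℓ} (P? : Decidable P) where

  isLeast? : Decidable (IsLeast P)
  isLeast? n = map′ to from (P? n ×-dec allUpTo? (λ m → ¬? (P? m)) n)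
    where
    to : P n × (∀ {m} → m < n → ¬ P m) → IsLeast P n
    to (Pn , below) = Pn , λ m Pm → ≮⇒≥ (λ m<n → below m<n Pm)

    from : IsLeast P n → P n × (∀ {m} → m < n → ¬ P m)
    from (Pn , n≤) = Pn , λ {m} m<n Pm → <⇒≱ m<n (n≤ m Pm)

  least : ∃ P → ∃ (IsLeast P)
  least (n , Pn) = <-rec (λ n → P n → ∃ (IsLeast P)) step n Pn
    where
    step : ∀ n → (∀ {m} → m < n → P m → ∃ (IsLeast P)) → P n → ∃ (IsLeast P)
    step n rec Pn with anyUpTo? P? n
    ... | yes (m , m<n , Pm) = rec m<n Pm
    ... | no  none = n , Pn , λ m Pm → ≮⇒≥ (λ m<n → none (m , m<n , Pm))

record Graph : Set₁ where
  field
    order  : ℕ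
    Adj    : Rel (Fin order) 0ℓ
    adj?   : ∀ u v → Dec (Adj u v)
    symm   : Symmetric Adj
    irrefl : ∀ {v} → ¬ Adj v v

  Vertex : Set
  Vertex = Fin order

open Graph public using (order; Vertex)

record _≅_ (G H : Graph) : Set where
  field
    bijection : Vertex G ↔ Vertex H
  open Inverse bijection using (to)
  field
    adjacency : ∀ u v → Graph.Adj G u v ⇔ Graph.Adj H (to u) (to v)

-- Graphs are counted up to isomorphism.
FinitelyMany : Pred Graph 0ℓ → Set₁
FinitelyMany P = ∃ λ (Gs : List Graph) → ∀ G → P G → Any (G ≅_) Gs

module _ (G : Graph) where
  open Graph G hiding (order; Vertex)

  degree : Vertex G → ℕ
  degree v = length (filter (adj? v) (allFin (order G)))

  -- The default 0 only matters for the graph with no vertices.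
  maxDegree : ℕ
  maxDegree = max 0 (map degree (allFin (order G)))

  infixr 5 _∷_

  data Walk : Vertex G → Vertex G → ℕ → Set where
    []  : ∀ {u} → Walk u u 0
    _∷_ : ∀ {u v w n} → Adj u v → Walk v w n → Walk u w (suc n)

  Connected : Set
  Connected = NonZero (order G) × (∀ u v → ∃ (Walk u v))

  IsDistance : Vertex G → Vertex G → ℕ → Set
  IsDistance u v = IsLeast (Walk u v)

  IsColouring : (c : ℕ) → (Vertex G → Fin c) → Set
  IsColouring c φ = ∀ u v → Adj u v → φ u ≢ φ v

  Colourable : ℕ → Set
  Colourable c = ∃ (IsColouring c)

  colourable? : Decidable Colourable
  colourable? c = map′
    (λ (i , p) → finToFun i , p)
    (λ (φ , p) → funToFin φ , λ u v a eq →
      p u v a (subst₂ _≡_ (finToFun-funToFin φ u) (finToFun-funToFin φ v) eq))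
    (any? λ i → all? λ u → all? λ v →
      adj? u v →-dec ¬? (finToFun {c} {order G} i u ≟ᶠ finToFun i v))

  order-colourable : Colourable (order G)
  order-colourable = id , λ u v a u≡v → irrefl (subst (Adj u) (sym u≡v) a)

  χ-least : ∃ (IsLeast Colourable)
  χ-least = least colourable? (order G , order-colourable)

  χ : ℕ
  χ = proj₁ χ-least

  walk? : ∀ u v n → Dec (Walk u v n)
  walk? u v zero = map′ (λ { refl → [] }) (λ { [] → refl }) (u ≟ᶠ v)
  walk? u v (suc n) = map′
    (λ (_ , a , p) → a ∷ p)
    (λ { (a ∷ p) → _ , a , p })
    (any? λ w → adj? u w ×-dec walk? w v n)

  reverse : ∀ {u v n} → Walk u v n → Walk v u n
  reverse []      = []
  reverse (a ∷ p) = snoc (reverse p) (symm a)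
    where
    snoc : ∀ {u v w n} → Walk u v n → Adj v w → Walk u w (suc n)
    snoc []      b = b ∷ []
    snoc (a ∷ p) b = a ∷ snoc p b

  PowerAdj : ℕ → Rel (Vertex G) 0ℓ
  PowerAdj k u v = u ≢ v × ∃ λ d → d ≤ k × IsDistance u v d

  powerAdj? : ∀ k u v → Dec (PowerAdj k u v)
  powerAdj? k u v = ¬? (u ≟ᶠ v) ×-dec map′
    (λ (d , d<1+k , p) → d , s≤s⁻¹ d<1+k , p)
    (λ (d , d≤k , p) → d , s≤s d≤k , p)
    (anyUpTo? (isLeast? (walk? u v)) (suc k))

power : Graph → ℕ → Graph
power G k = record
  { order  = order G
  ; Adj    = PowerAdj G k
  ; adj?   = powerAdj? G k
  ; symm   = λ (u≢v , d , d≤k , p , q) →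
      u≢v ∘ sym , d , d≤k , reverse G p , λ m r → q m (reverse G r)
  ; irrefl = λ (v≢v , _) → v≢v refl
  }

f : ℕ → ℤ → ℤ
f k Δ = Δ ℤ.* foldr ℤ._+_ 0ℤ (applyUpTo (λ i → (Δ ℤ.- 1ℤ) ℤ.^ i) k)

gap : ℕ → Graph → ℤ
gap k G = f k (+ maxDegree G) ℤ.+ 1ℤ ℤ.- + χ (power G k)

fromℤ : ℤ → ℚ
fromℤ i = i / 1

-- φ(k) = Θ(b^(k/q)) as k → ∞, for an integer base b ≥ 0 and q ≥ 1, i.e.
-- c₁ b^(k/q) ≤ φ(k) ≤ c₂ b^(k/q) for all large k, with constants c₁, c₂ > 0.
-- As b^(k/q) may be irrational, both inequalities (between non-negative
-- quantities) are raised to the q-th power.  The condition 0 ≤ φ(k) is needed: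
-- for even q the q-th powers do not see the sign of φ(k).
IsΘ-^[k/_] : ℕ → ℤ → (ℕ → ℚ) → Set
IsΘ-^[k/ q ] b φ =
  ∃ λ (c₁ : ℚ) → ∃ λ (c₂ : ℚ) → 0ℚ ℚ.< c₁ × 0ℚ ℚ.< c₂ ×
  ∃ λ (K : ℕ) → ∀ k → K ≤ k →
    0ℚ ℚ.≤ φ k ×
    (c₁ ^ℚ q) ℚ.* fromℤ (b ℤ.^ k) ℚ.≤ φ k ^ℚ q ×
    φ k ^ℚ q ℚ.≤ (c₂ ^ℚ q) ℚ.* fromℤ (b ℤ.^ k)

{-# OPTIONS --safe #-}
-- Colour G^k greedily by decreasing distance from a root r, with b = Δ - 1 and
-- h = b^e, where e ≈ k/12.  If some sphere around v of radius at most k - e is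
-- smaller than in the Δ-regular tree, then v has at most f(k,Δ) - h neighbours
-- in G^k and can be coloured at any time.  Otherwise G looks like that tree
-- around v, and a geodesic from v to r of length at least e + 3 has a point
-- with at least 3h vertices around it that are closer to r, hence coloured
-- after v.  For the remaining v, close to r, take r to be the midpoint of a
-- long geodesic with ends a and z, which exists once G has enough vertices: h
-- vertices near a and h vertices near z are all within distance k of v, but
-- the former are at distance more than k from the latter, so these 2h vertices
-- can be precoloured in pairs with only h colours.
module Submission where

open import Defs
open import Data.Empty using (⊥)
open import Data.Fin.Base using (Fin; inject≤; fromℕ<; finToFun; funToFin) renaming (zero to zeroᶠ; suc to sucᶠ)
open import Data.Fin.Properties using (any?; injective⇒≤; inject≤-injective; finToFun-funToFin) renaming (_≟_ to _≟ᶠ_)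
open import Data.Integer.Base as ℤ using (ℤ; +_; -[1+_]; 0ℤ; 1ℤ; ∣_∣) renaming (_≤_ to _≤ℤ_; _-_ to _-ℤ_)
import Data.Integer.Properties as ℤ
open import Data.List.Base using (List; []; _∷_; _++_; length; filter; map; concatMap; foldr; allFin; tabulate; lookup; upTo; applyUpTo)
open import Data.List.Membership.Propositional using (_∈_; lose)
open import Data.List.Membership.Propositional.Properties using (∈-allFin; ∈-concatMap⁺; ∈-filter⁺; ∈-filter⁻; ∈-lookup; ∈-map⁺; ∈-tabulate⁺; ∈-tabulate⁻; ∈-upTo⁺; ∈-++⁺ˡ; ∈-++⁺ʳ; ∈-++⁻)
open import Data.List.Properties using (length-++; length-map; length-tabulate)
open import Data.List.Relation.Binary.Permutation.Propositional using (↭-sym)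
open import Data.List.Relation.Binary.Permutation.Propositional.Properties using (∈-resp-↭)
import Data.List.Relation.Unary.All as All
open import Data.List.Relation.Unary.AllPairs using (AllPairs; []; _∷_)
open import Data.List.Relation.Unary.Any as Any using (Any; here; there)
open import Data.List.Relation.Unary.Any.Properties using (lookup-index)
open import Data.List.Relation.Unary.Sorted.TotalOrder.Properties using (Sorted⇒AllPairs)
open import Data.List.Relation.Unary.Unique.Propositional using (Unique)
import Data.List.Relation.Unary.Unique.Propositional.Properties as Unique
import Data.List.Sort
open import Data.Nat.Base using (ℕ; zero; suc; _+_; _*_; _∸_; _^_; _≤_; _<_; z≤n; s≤s; s≤s⁻¹)
open import Data.Nat.DivMod using (_/_; m≡m%n+[m/n]*n; m%n<n; m/n*n≤m; /-monoˡ-≤)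
open import Data.Nat.Properties
open import Data.List.Extrema ≤-totalOrder using (xs≤max)
open import Data.Nat.Tactic.RingSolver using (solve-∀)
open import Data.Product.Base using (∃; _×_; _,_; proj₁; proj₂)
open import Data.Rational.Base as ℚ using (ℚ; 0ℚ; 1ℚ) renaming (_<_ to _<ℚ_)
import Data.Rational.Properties as ℚ
open import Data.Rational.Unnormalised.Base as ℚᵘ using (mkℚᵘ)
import Data.Rational.Unnormalised.Properties as ℚᵘ
open import Data.Sum.Base using (_⊎_; inj₁; inj₂)
open import Function.Base using (_∘_; id)
open import Function.Bundles using (mk⇔)
open import Function.Construct.Identity using (↔-id)
open import Level using (0ℓ)
open import Relation.Binary.Bundles using (DecTotalOrder)
import Relation.Binary.Construct.On as On
open import Relation.Binary.Core using (Rel)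
open import Relation.Binary.Definitions using (Symmetric)
open import Relation.Binary.PropositionalEquality using (_≡_; _≢_; refl; sym; trans; cong; cong₂; subst; subst₂; module ≡-Reasoning)
open import Relation.Nullary using (¬_; Dec; yes; no; contradiction)
open import Relation.Nullary.Decidable using (_×-dec_; _⊎-dec_; ¬?; decidable-stable; from-yes)
open import Relation.Unary using (Pred; Decidable)

-- Duplicate-free lists and counting in finite sets.

lookup-injective : ∀ {A : Set} {xs : List A} → Unique xs →
                   ∀ {i j} → lookup xs i ≡ lookup xs j → i ≡ j
lookup-injective (_    ∷ _) {zeroᶠ}  {zeroᶠ}  _  = refl
lookup-injective (x∉xs ∷ _) {zeroᶠ}  {sucᶠ j} eq = contradiction eq (All.lookup x∉xs (∈-lookup j))
lookup-injective (x∉xs ∷ _) {sucᶠ i} {zeroᶠ}  eq = contradiction (sym eq) (All.lookup x∉xs (∈-lookup i))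
lookup-injective (_    ∷ u) {sucᶠ _} {sucᶠ _} eq = cong sucᶠ (lookup-injective u eq)

-- Pigeonhole principle: sending each position of `xs` to a position of the same entry in `ys` is
-- injective, since `xs` has no repetitions. The comparisons of `count` below rest on it.
unique⇒length≤ : ∀ {A : Set} {xs ys : List A} → Unique xs →
                 (∀ {x} → x ∈ xs → x ∈ ys) → length xs ≤ length ys
unique⇒length≤ {xs = xs} {ys} u sub = injective⇒≤ {f = position} position-injective
  where
  position : Fin (length xs) → Fin (length ys)
  position i = Any.index (sub (∈-lookup i))

  position-injective : ∀ {i j} → position i ≡ position j → i ≡ j
  position-injective {i} {j} eq = lookup-injective u
    (trans (lookup-index (sub (∈-lookup i)))
           (trans (cong (lookup ys) eq) (sym (lookup-index (sub (∈-lookup j))))))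

length-concatMap≤ : ∀ {A B : Set} (g : A → List B) {m} xs →
                    (∀ {x} → x ∈ xs → length (g x) ≤ m) → length (concatMap g xs) ≤ m * length xs
length-concatMap≤ g {m} []       _ = z≤n
length-concatMap≤ g {m} (x ∷ xs) g≤m = begin
  length (g x ++ concatMap g xs)          ≡⟨ length-++ (g x) ⟩
  length (g x) + length (concatMap g xs)  ≤⟨ +-mono-≤ (g≤m (here refl)) (length-concatMap≤ g xs (g≤m ∘ there)) ⟩
  m + m * length xs                       ≡⟨ *-suc m (length xs) ⟨
  m * suc (length xs)                     ∎
  where open ≤-Reasoning

module _ {n : ℕ} where

  members : {P : Pred (Fin n) 0ℓ} → Decidable P → List (Fin n)
  members P? = filter P? (allFin n)

  count : {P : Pred (Fin n) 0ℓ} → Decidable P → ℕ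
  count P? = length (members P?)

  module _ {P : Pred (Fin n) 0ℓ} (P? : Decidable P) where

    ∈-members : ∀ {x} → P x → x ∈ members P?
    ∈-members Px = ∈-filter⁺ P? (∈-allFin _) Px

    ∈-members⁻ : ∀ {x} → x ∈ members P? → P x
    ∈-members⁻ x∈ = proj₂ (∈-filter⁻ P? {xs = allFin n} x∈)

    members-unique : Unique (members P?)
    members-unique = Unique.filter⁺ P? (Unique.allFin⁺ n)

    count≤length : ∀ {ys} → (∀ {x} → P x → x ∈ ys) → count P? ≤ length ys
    count≤length cover = unique⇒length≤ members-unique (cover ∘ ∈-members⁻)

    injection⇒≤count : ∀ {q} (g : Fin q → Fin n) → (∀ {i j} → g i ≡ g j → i ≡ j) →
                       (∀ i → P (g i)) → q ≤ count P?
    injection⇒≤count g inj Pg = subst (_≤ count P?) (length-tabulate g)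
      (unique⇒length≤ (Unique.tabulate⁺ inj) (λ x∈ → member (∈-tabulate⁻ x∈)))
      where
      member : ∀ {x} → (∃ λ i → x ≡ g i) → x ∈ members P?
      member (i , refl) = ∈-members (Pg i)

    ≤count⇒injection : ∀ {q} → q ≤ count P? →
      ∃ λ (g : Fin q → Fin n) → (∀ {i j} → g i ≡ g j → i ≡ j) × (∀ i → P (g i))
    ≤count⇒injection q≤ =
      (λ i → lookup (members P?) (inject≤ i q≤)) ,
      (λ eq → inject≤-injective q≤ q≤ _ _ (lookup-injective members-unique eq)) ,
      (λ i → ∈-members⁻ (∈-lookup (inject≤ i q≤)))

  module _ {P Q : Pred (Fin n) 0ℓ} (P? : Decidable P) (Q? : Decidable Q) where

    count-mono : (∀ {x} → P x → Q x) → count P? ≤ count Q?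
    count-mono P⊆Q = count≤length P? (∈-members Q? ∘ P⊆Q)

    count-strict : ∀ {z} → Q z → ¬ P z → (∀ {x} → P x → Q x) → suc (count P?) ≤ count Q?
    count-strict {z} Qz ¬Pz P⊆Q = unique⇒length≤
      (All.tabulate (λ { x∈ refl → ¬Pz (∈-members⁻ P? x∈) }) ∷ members-unique P?)
      (λ { (here refl) → ∈-members Q? Qz ; (there x∈) → ∈-members Q? (P⊆Q (∈-members⁻ P? x∈)) })

    count-disjoint : {T : Pred (Fin n) 0ℓ} (T? : Decidable T) → (∀ {x} → P x → ¬ Q x) →
                     (∀ {x} → P x → T x) → (∀ {x} → Q x → T x) → count P? + count Q? ≤ count T?
    count-disjoint {T} T? disjoint P⊆T Q⊆T = subst (_≤ count T?) (length-++ (members P?))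
      (unique⇒length≤ (Unique.++⁺ (members-unique P?) (members-unique Q?)
        (λ (x∈P , x∈Q) → disjoint (∈-members⁻ P? x∈P) (∈-members⁻ Q? x∈Q)))
        (λ x∈ → ∈-members T? (inT (∈-++⁻ (members P?) x∈))))
      where
      inT : ∀ {x} → x ∈ members P? ⊎ x ∈ members Q? → T x
      inT (inj₁ x∈P) = P⊆T (∈-members⁻ P? x∈P)
      inT (inj₂ x∈Q) = Q⊆T (∈-members⁻ Q? x∈Q)

    count-cover : {T : Pred (Fin n) 0ℓ} (T? : Decidable T) → (∀ {x} → T x → P x ⊎ Q x) →
                  count T? ≤ count P? + count Q?
    count-cover {T} T? T⊆P∪Q = subst (count T? ≤_) (length-++ (members P?))
      (count≤length T? (λ Tx → within (T⊆P∪Q Tx)))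
      where
      within : ∀ {x} → P x ⊎ Q x → x ∈ members P? ++ members Q?
      within (inj₁ Px) = ∈-++⁺ˡ (∈-members P? Px)
      within (inj₂ Qx) = ∈-++⁺ʳ (members P?) (∈-members Q? Qx)

count-image≤ : ∀ {n q} {P : Pred (Fin n) 0ℓ} (P? : Decidable P) (g : Fin q → Fin n) →
               (∀ {x} → P x → ∃ λ i → g i ≡ x) → count P? ≤ q
count-image≤ P? g onto = subst (count P? ≤_) (length-tabulate g)
  (count≤length P? (λ Px → hit (onto Px)))
  where
  hit : ∀ {x} → (∃ λ i → g i ≡ x) → x ∈ tabulate g
  hit (i , refl) = ∈-tabulate⁺ i

-- Greedy colouring with a precoloured set.

fresh : ∀ {c} (ys : List (Fin c)) → length ys < c → ∃ λ x → ¬ (x ∈ ys)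
fresh {c} ys |ys|<c with any? (λ x → ¬? (Any.any? (x ≟ᶠ_) ys))
... | yes found = found
... | no  none  = contradiction
  (subst (_≤ length ys) (length-tabulate {n = c} id)
    (unique⇒length≤ (Unique.allFin⁺ c) (λ {x} _ → decidable-stable (Any.any? (x ≟ᶠ_) ys) (λ x∉ → none (x , x∉)))))
  (<⇒≱ |ys|<c)

-- The vertices of Sp are precoloured by φ₀; the others are coloured by
-- decreasing ρ, so x only has to avoid Sp and the u with ρ x ≤ ρ u.
module Greedy {n c : ℕ} (N : Rel (Fin n) 0ℓ) (N-sym : Symmetric N) (N-irrefl : ∀ {v : Fin n} → ¬ N v v)
  {Sp : Pred (Fin n) 0ℓ} (Sp? : Decidable Sp) (φ₀ : Fin n → Fin c)
  (φ₀-proper : ∀ (u w : Fin n) → Sp u → Sp w → N u w → φ₀ u ≢ φ₀ w)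
  (ρ : Fin n → ℕ)
  (few : ∀ (φ : Fin n → Fin c) → (∀ (u : Fin n) → Sp u → φ u ≡ φ₀ u) → ∀ (x : Fin n) → ¬ Sp x →
         ∃ λ (L : List (Fin c)) → length L < c × (∀ (u : Fin n) → N x u → Sp u ⊎ ρ x ≤ ρ u → φ u ∈ L))
  where

  private
    byRank : DecTotalOrder 0ℓ 0ℓ 0ℓ
    byRank = On.decTotalOrder ≤-decTotalOrder ρ

    open Data.List.Sort byRank using (sort; sort-↭; sort-↗)

    Extends : List (Fin n) → (Fin n → Fin c) → Set
    Extends xs φ = (∀ u → Sp u → φ u ≡ φ₀ u) ×
      (∀ u w → Sp u ⊎ u ∈ xs → Sp w ⊎ w ∈ xs → N u w → φ u ≢ φ w)

    recolour : Fin n → Fin c → (Fin n → Fin c) → Fin n → Fin c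
    recolour x col φ u with u ≟ᶠ x
    ... | yes _ = col
    ... | no  _ = φ u

    shrink : ∀ {u x xs} → u ≢ x → Sp u ⊎ u ∈ x ∷ xs → Sp u ⊎ u ∈ xs
    shrink u≢x (inj₁ s)            = inj₁ s
    shrink u≢x (inj₂ (here u≡x))   = contradiction u≡x u≢x
    shrink u≢x (inj₂ (there u∈xs)) = inj₂ u∈xs

    -- The recursion colours the tail first, so a list sorted by increasing `ρ` is treated from its
    -- end. When `x` gets its turn, only `Sp` and the tail are coloured; the tail has rank at least
    -- `ρ x`, so `few` bounds the colours to avoid.
    colour-all : ∀ xs → AllPairs (λ u w → ρ u ≤ ρ w) xs → ∃ (Extends xs)
    colour-all [] [] = φ₀ , (λ _ _ → refl) , proper
      where
      proper : ∀ u w → Sp u ⊎ u ∈ [] → Sp w ⊎ w ∈ [] → N u w → φ₀ u ≢ φ₀ w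
      proper u w (inj₁ su) (inj₁ sw) = φ₀-proper u w su sw
    colour-all (x ∷ xs) (x≤xs ∷ sorted) with colour-all xs sorted | Sp? x
    ... | φ , agree , proper | yes sx = φ , agree , λ u w u∈ w∈ → proper u w (drop u∈) (drop w∈)
      where
      drop : ∀ {u} → Sp u ⊎ u ∈ x ∷ xs → Sp u ⊎ u ∈ xs
      drop (inj₁ s)             = inj₁ s
      drop (inj₂ (here refl))   = inj₁ sx
      drop (inj₂ (there u∈xs))  = inj₂ u∈xs
    ... | φ , agree , proper | no ¬sx = recolour x col φ , agree′ , proper′
      where
      L = proj₁ (few φ agree x ¬sx)
      seen : ∀ u → N x u → Sp u ⊎ u ∈ xs → φ u ∈ L
      seen u a (inj₁ s)    = proj₂ (proj₂ (few φ agree x ¬sx)) u a (inj₁ s)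
      seen u a (inj₂ u∈xs) = proj₂ (proj₂ (few φ agree x ¬sx)) u a (inj₂ (All.lookup x≤xs u∈xs))

      new = fresh L (proj₁ (proj₂ (few φ agree x ¬sx)))
      col = proj₁ new

      agree′ : ∀ u → Sp u → recolour x col φ u ≡ φ₀ u
      agree′ u su with u ≟ᶠ x
      ... | yes refl = contradiction su ¬sx
      ... | no  _    = agree u su

      proper′ : ∀ u w → Sp u ⊎ u ∈ x ∷ xs → Sp w ⊎ w ∈ x ∷ xs → N u w → recolour x col φ u ≢ recolour x col φ w
      proper′ u w u∈ w∈ a with u ≟ᶠ x | w ≟ᶠ x
      ... | yes refl | yes refl = contradiction a N-irrefl
      ... | yes refl | no  w≢x  = λ eq → proj₂ new (subst (_∈ L) (sym eq) (seen w a (shrink w≢x w∈)))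
      ... | no  u≢x  | yes refl = λ eq → proj₂ new (subst (_∈ L) eq (seen u (N-sym a) (shrink u≢x u∈)))
      ... | no  u≢x  | no  w≢x  = proper u w (shrink u≢x u∈) (shrink w≢x w∈) a

  greedy : ∃ λ (φ : Fin n → Fin c) → ∀ u w → N u w → φ u ≢ φ w
  greedy with colour-all (sort (allFin n)) (Sorted⇒AllPairs (DecTotalOrder.totalOrder byRank) (sort-↗ (allFin n)))
  ... | φ , _ , proper = φ , λ u w → proper u w (inj₂ (all u)) (inj₂ (all w))
    where
    all : ∀ u → u ∈ sort (allFin n)
    all u = ∈-resp-↭ (↭-sym (sort-↭ (allFin n))) (∈-allFin u)

-- Distance layers compared with those of the Δ-regular tree.

-- This is `f` built up level by level: in the tree, `Δ * (Δ ∸ 1) ^ k` vertices lie at distance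
-- `k + 1` from the root.
fℕ : ℕ → ℕ → ℕ
fℕ Δ zero    = 0
fℕ Δ (suc k) = fℕ Δ k + Δ * (Δ ∸ 1) ^ k

-- Base 0 has to be allowed, since `Δ ∸ 1` vanishes for `Δ ≤ 1`; there `0 ^ 0` exceeds `0 ^ 1`,
-- whence `1 ≤ e`.
^-monoʳ-≤-pos : ∀ b {e j} → 1 ≤ e → e ≤ j → b ^ e ≤ b ^ j
^-monoʳ-≤-pos zero    {suc e} _ _   = z≤n
^-monoʳ-≤-pos (suc b) {e}     _ e≤j = ^-monoʳ-≤ (suc b) e≤j

module _ (G : Graph) where
  open Graph G using (Adj; adj?; symm)

  private V = Vertex G

  degree≤maxDegree : ∀ v → degree G v ≤ maxDegree G
  degree≤maxDegree v = All.lookup (xs≤max 0 (map (degree G) (allFin (order G)))) (∈-map⁺ (degree G) (∈-allFin v))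

  concat : ∀ {u v w m n} → Walk G u v m → Walk G v w n → Walk G u w (m + n)
  concat []      q = q
  concat (a ∷ p) q = a ∷ concat p q

  split : ∀ m {n u w} → Walk G u w (m + n) → ∃ λ v → Walk G u v m × Walk G v w n
  split zero    p       = _ , [] , p
  split (suc m) (a ∷ p) = let v , q , r = split m p in v , a ∷ q , r

  module Metric {Δ : ℕ} (degree≤Δ : ∀ v → degree G v ≤ Δ)
                (d : V → V → ℕ) (d-isDistance : ∀ u v → IsDistance G u v (d u v)) where

    geodesic : ∀ u v → Walk G u v (d u v)
    geodesic u v = proj₁ (d-isDistance u v)

    d-min : ∀ {u v m} → Walk G u v m → d u v ≤ m
    d-min {u} {v} {m} p = proj₂ (d-isDistance u v) m p

    d-refl : ∀ u → d u u ≡ 0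
    d-refl u = n≤0⇒n≡0 (d-min [])

    d-sym : ∀ u v → d u v ≡ d v u
    d-sym u v = ≤-antisym (d-min (reverse G (geodesic v u))) (d-min (reverse G (geodesic u v)))

    d-triangle : ∀ u v w → d u w ≤ d u v + d v w
    d-triangle u v w = d-min (concat (geodesic u v) (geodesic v w))

    d-adj : ∀ v {w u} → Adj w u → d v u ≤ suc (d v w)
    d-adj v {w} {u} a = ≤-trans (d-min (concat (geodesic v w) (a ∷ []))) (≤-reflexive (+-comm _ 1))

    d≡0⇒≡ : ∀ {u v} → d u v ≡ 0 → u ≡ v
    d≡0⇒≡ {u} {v} eq with [] ← subst (Walk G u v) eq (geodesic u v) = refl

    -- Cut a geodesic after `m` steps: the two pieces bound the distances from above, and the
    -- triangle inequality leaves no slack.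
    between : ∀ {u w} m {n} → d u w ≡ m + n → ∃ λ v → d u v ≡ m × d v w ≡ n
    between {u} {w} m {n} eq with split m (subst (Walk G u w) eq (geodesic u w))
    ... | v , p , q = v , ≤-antisym (d-min p) m≤ , ≤-antisym (d-min q) n≤
      where
      m+n≤ : m + n ≤ d u v + d v w
      m+n≤ = subst (_≤ d u v + d v w) eq (d-triangle u v w)
      m≤ : m ≤ d u v
      m≤ = +-cancelʳ-≤ n m (d u v) (≤-trans m+n≤ (+-monoʳ-≤ (d u v) (d-min q)))
      n≤ : n ≤ d v w
      n≤ = +-cancelˡ-≤ m n (d v w) (≤-trans m+n≤ (+-monoˡ-≤ (d v w) (d-min p)))

    -- The first step of a geodesic from `u` back to `v`.
    parent : ∀ {v u i} → d v u ≡ suc i → ∃ λ w → Adj w u × d v w ≡ i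
    parent {v} {u} {i} eq with subst (Walk G u v) (trans (d-sym u v) eq) (geodesic u v)
    ... | _∷_ {v = w} a p = w , symm a , ≤-antisym
      (≤-trans (≤-reflexive (d-sym v w)) (d-min p))
      (s≤s⁻¹ (≤-trans (≤-reflexive (sym eq)) (d-adj v (symm a))))

    private
      b : ℕ
      b = Δ ∸ 1

    sphere? : ∀ v i → Decidable (λ u → d v u ≡ i)
    sphere? v i u = d v u ≟ i

    children? : ∀ v w → Decidable (λ u → Adj w u × d v u ≡ suc (d v w))
    children? v w u = adj? w u ×-dec (d v u ≟ suc (d v w))

    -- One of the at most `Δ` neighbours of `w` is its parent, which lies two levels below the
    -- children.
    count-children≤ : ∀ {v w i} → d v w ≡ suc i → count (children? v w) ≤ b
    count-children≤ {v} {w} {i} eq with parent eq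
    ... | z , z~w , dz≡i = ∸-monoˡ-≤ 1 (≤-trans
      (count-strict (children? v w) (adj? w) (symm z~w)
        (λ (_ , dz≡) → m≢1+n+m i {1} (trans (sym dz≡i) (trans dz≡ (cong suc eq)))) proj₁)
      (degree≤Δ w))

    -- Every vertex of `Y` is a child of some vertex of `X`, and each of these has at most `b`
    -- children. Parts of levels are allowed so that the descendants of a given vertex can be left
    -- out.
    level-step : ∀ v i {X Y : Pred V 0ℓ} (X? : Decidable X) (Y? : Decidable Y) →
                 (∀ {w} → X w → d v w ≡ suc i) → (∀ {u} → Y u → d v u ≡ suc (suc i)) →
                 (∀ {w u} → Y u → Adj w u → d v w ≡ suc i → X w) → count Y? ≤ b * count X?
    level-step v i {X} {Y} X? Y? X-level Y-level back = ≤-trans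
      (count≤length Y? cover)
      (length-concatMap≤ (members ∘ children? v) (members X?) (λ w∈ → count-children≤ (X-level (∈-members⁻ X? w∈))))
      where
      cover : ∀ {u} → Y u → u ∈ concatMap (members ∘ children? v) (members X?)
      cover {u} Yu with parent (Y-level Yu)
      ... | w , w~u , dw = ∈-concatMap⁺ (members ∘ children? v) (lose (∈-members X? (back Yu w~u dw))
        (∈-members (children? v w) (w~u , trans (Y-level Yu) (cong suc (sym dw)))))

    private
      pull : ∀ x y z → x * (y * z) ≡ y * (x * z)
      pull = solve-∀

    sphere≤ : ∀ v i → count (sphere? v (suc i)) ≤ Δ * b ^ i
    sphere≤ v zero = begin
      count (sphere? v 1)  ≤⟨ count-mono (sphere? v 1) (adj? v) adjacent ⟩
      degree G v           ≤⟨ degree≤Δ v ⟩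
      Δ                    ≡⟨ *-identityʳ Δ ⟨
      Δ * 1                ∎
      where
      open ≤-Reasoning
      adjacent : ∀ {u} → d v u ≡ 1 → Adj v u
      adjacent eq with parent eq
      ... | w , w~u , dw≡0 with refl ← d≡0⇒≡ dw≡0 = w~u
    sphere≤ v (suc i) = begin
      count (sphere? v (suc (suc i)))  ≤⟨ level-step v i (sphere? v (suc i)) (sphere? v (suc (suc i))) id id (λ _ _ dw → dw) ⟩
      b * count (sphere? v (suc i))    ≤⟨ *-monoʳ-≤ b (sphere≤ v i) ⟩
      b * (Δ * b ^ i)                  ≡⟨ pull b Δ (b ^ i) ⟩
      Δ * (b * b ^ i)                  ∎
      where open ≤-Reasoning

    -- Adjacency in the `k`-th power, in terms of the distance function.
    Near : ℕ → V → V → Set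
    Near k v u = u ≢ v × d v u ≤ k

    near? : ∀ k v → Decidable (Near k v)
    near? k v u = ¬? (u ≟ᶠ v) ×-dec (d v u ≤? k)

    count-near-suc : ∀ k v → count (near? (suc k) v) ≤ count (near? k v) + count (sphere? v (suc k))
    count-near-suc k v = count-cover (near? k v) (sphere? v (suc k)) (near? (suc k) v) peel
      where
      peel : ∀ {u} → Near (suc k) v u → Near k v u ⊎ d v u ≡ suc k
      peel (u≢v , du≤) with m≤n⇒m<n∨m≡n du≤
      ... | inj₁ du<  = inj₁ (u≢v , s≤s⁻¹ du<)
      ... | inj₂ du≡ = inj₂ du≡

    count-near≤fℕ : ∀ k v → count (near? k v) ≤ fℕ Δ k
    count-near≤fℕ zero v = count≤length (near? 0 v) {ys = []}
      (λ (u≢v , du≤0) → contradiction (sym (d≡0⇒≡ (n≤0⇒n≡0 du≤0))) u≢v)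
    count-near≤fℕ (suc k) v = ≤-trans (count-near-suc k v) (+-mono-≤ (count-near≤fℕ k v) (sphere≤ v k))

    -- The index is off by one: the sphere of radius `i + 1` is as large as in the tree.
    Full : V → ℕ → Set
    Full v i = Δ * b ^ i ≤ count (sphere? v (suc i))

    full? : ∀ v i → Dec (Full v i)
    full? v i = Δ * b ^ i ≤? count (sphere? v (suc i))

    -- A single vertex missing from the sphere of radius i + 1 costs all its
    -- b ^ j potential descendants j levels further out.
    sphere-loss : ∀ {v i} → ¬ Full v i → ∀ j → count (sphere? v (suc (j + i))) + b ^ j ≤ Δ * b ^ (j + i)
    sphere-loss {v} {i} ¬full zero = ≤-trans (≤-reflexive (+-comm _ 1)) (≰⇒> ¬full)
    sphere-loss {v} {i} ¬full (suc j) = begin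
      count (sphere? v (suc (suc j + i))) + b * b ^ j
        ≤⟨ +-monoˡ-≤ _ (level-step v (j + i) (sphere? v (suc (j + i))) (sphere? v (suc (suc j + i))) id id (λ _ _ dw → dw)) ⟩
      b * count (sphere? v (suc (j + i))) + b * b ^ j
        ≡⟨ *-distribˡ-+ b _ (b ^ j) ⟨
      b * (count (sphere? v (suc (j + i))) + b ^ j)
        ≤⟨ *-monoʳ-≤ b (sphere-loss ¬full j) ⟩
      b * (Δ * b ^ (j + i))
        ≡⟨ pull b Δ _ ⟩
      Δ * (b * b ^ (j + i)) ∎
      where open ≤-Reasoning

    -- With `k = suc (j + i)` and `e ≤ j`, the outermost sphere alone lacks `b ^ j` vertices, and
    -- the inner ones are no larger than in the tree.
    near-loss : ∀ {v i k e} → ¬ Full v i → 1 ≤ e → suc i + e ≤ k → count (near? k v) + b ^ e ≤ fℕ Δ k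
    near-loss {v} {i} {k} {e} ¬full 1≤e i+e<k with m≤n⇒∃[o]m+o≡n (m+n≤o⇒m≤o (suc i) i+e<k)
    ... | j , refl rewrite +-comm i j = begin
      count (near? (suc (j + i)) v) + b ^ e
        ≤⟨ +-mono-≤ (count-near-suc (j + i) v) (^-monoʳ-≤-pos b 1≤e e≤j) ⟩
      count (near? (j + i) v) + count (sphere? v (suc (j + i))) + b ^ j
        ≡⟨ +-assoc (count (near? (j + i) v)) _ _ ⟩
      count (near? (j + i) v) + (count (sphere? v (suc (j + i))) + b ^ j)
        ≤⟨ +-mono-≤ (count-near≤fℕ (j + i) v) (sphere-loss ¬full j) ⟩
      fℕ Δ (suc (j + i)) ∎
      where
      open ≤-Reasoning
      e≤j : e ≤ j
      e≤j = +-cancelˡ-≤ i e j (≤-trans (s≤s⁻¹ i+e<k) (≤-reflexive (+-comm j i)))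

    module _ {v p j} (dp : d v p ≡ suc j) where

      -- Levels above p in the layering by distance from v: Above i are the
      -- descendants of p after i steps, Aside i the rest of the level.
      Above Aside : ℕ → Pred V 0ℓ
      Above i u = d v u ≡ suc (i + j) × d p u ≤ i
      Aside i u = d v u ≡ suc (i + j) × ¬ d p u ≤ i

      above? : ∀ i → Decidable (Above i)
      above? i u = (d v u ≟ suc (i + j)) ×-dec (d p u ≤? i)

      aside? : ∀ i → Decidable (Aside i)
      aside? i u = (d v u ≟ suc (i + j)) ×-dec ¬? (d p u ≤? i)

      -- On the level of `p` itself, leaving out `p` saves one vertex. A parent of a vertex of
      -- `Aside (suc i)` is again aside, so each further level multiplies the saving by `b`.
      count-aside≤ : ∀ i → count (aside? i) + b ^ i ≤ Δ * b ^ (i + j)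
      count-aside≤ zero = begin
        count (aside? 0) + 1       ≡⟨ +-comm _ 1 ⟩
        suc (count (aside? 0))     ≤⟨ count-strict (aside? 0) (sphere? v (suc j)) dp (λ (_ , far) → far (≤-reflexive (d-refl p))) proj₁ ⟩
        count (sphere? v (suc j))  ≤⟨ sphere≤ v j ⟩
        Δ * b ^ j                  ∎
        where open ≤-Reasoning
      count-aside≤ (suc i) = begin
        count (aside? (suc i)) + b * b ^ i  ≤⟨ +-monoˡ-≤ _ (level-step v (i + j) (aside? i) (aside? (suc i)) proj₁ proj₁ back) ⟩
        b * count (aside? i) + b * b ^ i    ≡⟨ *-distribˡ-+ b _ (b ^ i) ⟨
        b * (count (aside? i) + b ^ i)      ≤⟨ *-monoʳ-≤ b (count-aside≤ i) ⟩
        b * (Δ * b ^ (i + j))               ≡⟨ pull b Δ _ ⟩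
        Δ * (b * b ^ (i + j))               ∎
        where
        open ≤-Reasoning
        back : ∀ {w u} → Aside (suc i) u → Adj w u → d v w ≡ suc (i + j) → Aside i w
        back (_ , far) w~u dw = dw , λ dpw≤i → far (≤-trans (d-adj p w~u) (s≤s dpw≤i))

      -- `Aside` falls short of a full level by at least `b ^ i`, and `Above` has to make up the
      -- difference.
      above≥ : ∀ {i} → Full v (i + j) → b ^ i ≤ count (above? i)
      above≥ {i} full = +-cancelˡ-≤ (count (aside? i)) _ _ (begin
        count (aside? i) + b ^ i               ≤⟨ count-aside≤ i ⟩
        Δ * b ^ (i + j)                        ≤⟨ full ⟩
        count (sphere? v (suc (i + j)))        ≤⟨ count-cover (aside? i) (above? i) (sphere? v (suc (i + j))) side ⟩
        count (aside? i) + count (above? i)    ∎)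
        where
        open ≤-Reasoning
        side : ∀ {u} → d v u ≡ suc (i + j) → Aside i u ⊎ Above i u
        side {u} du with d p u ≤? i
        ... | yes dpu≤i = inj₂ (du , dpu≤i)
        ... | no  far   = inj₁ (du , far)

    -- Otherwise `v` and its at most `fℕ Δ k` neighbours in the power would be all vertices.
    exists-beyond : ∀ k v → suc (fℕ Δ k) < order G → ∃ λ u → k < d v u
    exists-beyond k v large with any? (λ u → k <? d v u)
    ... | yes found = found
    ... | no  none  = contradiction (begin
      order G                    ≡⟨ length-tabulate {n = order G} id ⟨
      length (allFin (order G))  ≤⟨ unique⇒length≤ (Unique.allFin⁺ (order G)) covered ⟩
      suc (count (near? k v))    ≤⟨ s≤s (count-near≤fℕ k v) ⟩
      suc (fℕ Δ k)               ∎) (<⇒≱ large)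
      where
      open ≤-Reasoning
      covered : ∀ {u} → u ∈ allFin (order G) → u ∈ v ∷ members (near? k v)
      covered {u} _ with u ≟ᶠ v
      ... | yes u≡v = here u≡v
      ... | no  u≢v = there (∈-members (near? k v) (u≢v , ≮⇒≥ (λ k<d → none (u , k<d))))

    geodesic-centre : ∀ s → V → suc (fℕ Δ (s + s)) < order G →
                      ∃ λ a → ∃ λ r → ∃ λ z → d a r ≡ s × d r z ≡ s × d a z ≡ s + s
    geodesic-centre s a large with exists-beyond (s + s) a large
    ... | u , 2s<d with between (s + s) (sym (m+[n∸m]≡n (<⇒≤ 2s<d)))
    ... | z , dz , _ with between s dz
    ... | r , dr , drz = a , r , z , dr , drz , dz

fℕ-mono : ∀ Δ {k m} → k ≤ m → fℕ Δ k ≤ fℕ Δ m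
fℕ-mono Δ {k} k≤m with m≤n⇒∃[o]m+o≡n k≤m
... | o , refl = go o
  where
  go : ∀ o → fℕ Δ k ≤ fℕ Δ (k + o)
  go zero    = ≤-reflexive (cong (fℕ Δ) (sym (+-identityʳ k)))
  go (suc o) = ≤-trans (go o) (≤-trans (m≤m+n _ _) (≤-reflexive (cong (fℕ Δ) (sym (+-suc k o)))))

-- The tree levels `e + 1` and `e + 2` contribute one summand each. Consequently `fℕ Δ k ∸ h` is a
-- true difference, and the palette has room for the `h` colours of the pairs.
2*power≤fℕ : ∀ Δ {e k} → 1 ≤ e → 2 + e ≤ k → (Δ ∸ 1) ^ e + (Δ ∸ 1) ^ e ≤ fℕ Δ k
2*power≤fℕ zero {suc e} _ _ = z≤n
2*power≤fℕ (suc b) {e} {k} 1≤e 2+e≤k = begin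
  b ^ e + b ^ e                     ≤⟨ +-mono-≤ (m≤n+m _ _) (^-monoʳ-≤-pos b 1≤e (n≤1+n e)) ⟩
  fℕ (suc b) e + b ^ e + b ^ suc e  ≤⟨ +-mono-≤ (+-monoʳ-≤ (fℕ (suc b) e) (m≤m+n _ _)) (m≤m+n _ _) ⟩
  fℕ (suc b) (2 + e)                ≤⟨ fℕ-mono (suc b) 2+e≤k ⟩
  fℕ (suc b) k                      ∎
  where open ≤-Reasoning

2+e≤s+3e+2 : ∀ e s → 2 + e ≤ s + (3 * e + 2)
2+e≤s+3e+2 e s = ≤-trans (≤-trans (≤-reflexive (+-comm 2 e)) (+-monoˡ-≤ 2 (m≤m+n e _))) (m≤n+m _ s)

-- Saving colours in the k-th power of a graph.

module _ (G : Graph) {Δ : ℕ} (degree≤Δ : ∀ v → degree G v ≤ Δ)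
         (d : Vertex G → Vertex G → ℕ) (d-isDistance : ∀ u v → IsDistance G u v (d u v)) where
  open Metric G degree≤Δ d d-isDistance
  private
    V = Vertex G
    b = Δ ∸ 1

  Near-sym : ∀ {k u v} → Near k u v → Near k v u
  Near-sym {k} {u} {v} (v≢u , duv≤k) = v≢u ∘ sym , subst (_≤ k) (d-sym u v) duv≤k

  -- The plain greedy bound: nothing is precoloured and the order is arbitrary.
  near-colourable : ∀ k → ∃ λ (φ : V → Fin (suc (fℕ Δ k))) → ∀ u w → Near k u w → φ u ≢ φ w
  near-colourable k = Greedy.greedy (Near k) Near-sym (λ (v≢v , _) → v≢v refl)
    {Sp = λ _ → ⊥} (λ _ → no id) (λ _ → zeroᶠ) (λ _ _ ()) (λ _ → 0)
    (λ φ _ x _ → map φ (members (near? k x)) ,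
      s≤s (≤-trans (≤-reflexive (length-map φ (members (near? k x)))) (count-near≤fℕ k x)) ,
      (λ u x~u _ → ∈-map⁺ φ (∈-members (near? k x) x~u)))

  -- s is half the length of the geodesic: balls of radius e around its ends are
  -- 2(s - e) > k apart, and they lie within s + 2e + 2 = k - e of every vertex at
  -- distance at most e + 2 from its midpoint.
  module Core {e s : ℕ} (1≤e : 1 ≤ e) (5e+3≤s : 5 * e + 3 ≤ s) where

    private
      h k : ℕ
      h = b ^ e
      k = s + (3 * e + 2)

    -- Full spheres of radius 1 to `k - e`: these are the radii at which one missing vertex would
    -- cost at least `h` vertices by radius `k`.
    FullUpTo : V → Set
    FullUpTo v = ∀ i → suc i + e ≤ k → Full v i

    full-or-loss : ∀ v → FullUpTo v ⊎ count (near? k v) + h ≤ fℕ Δ k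
    full-or-loss v with anyUpTo? (λ i → ¬? (full? v i)) (k ∸ e)
    ... | yes (i , i<k∸e , ¬full) = inj₂ (near-loss ¬full 1≤e
          (≤-trans (+-monoˡ-≤ e i<k∸e) (≤-reflexive (m∸n+n≡m e≤k))))
      where
      e≤k : e ≤ k
      e≤k = ≤-trans (≤-trans (m≤m+n e _) (m≤m+n _ 2)) (m≤n+m _ s)
    ... | no none = inj₁ λ i i+e<k → decidable-stable (full? v i)
          (λ ¬full → none (i , m+n≤o⇒m≤o∸n (suc i) i+e<k , ¬full))

    -- The pairs (as i , bs i) are to be coloured alike; both vertices are visible
    -- from every vertex near r that has no slack of its own.
    record Pairing (r : V) : Set where
      field
        size     : ℕ
        size≤h   : size ≤ h
        as bs    : Fin size → V
        as-inj   : ∀ {i j} → as i ≡ as j → i ≡ j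
        bs-inj   : ∀ {i j} → bs i ≡ bs j → i ≡ j
        apart    : ∀ i j → k < d (as i) (bs j)
        seen     : ∀ v → d r v ≤ e + 2 → FullUpTo v →
                   h ≤ size × (∀ i → d v (as i) ≤ k) × (∀ i → d v (bs i) ≤ k)

    module _ {r : V} (pairing : Pairing r) where
      open Pairing pairing

      private
        c : ℕ
        c = suc (fℕ Δ k ∸ h)

        ρ : V → ℕ
        ρ = d r

        size≤c : size ≤ c
        size≤c = begin
          size             ≤⟨ size≤h ⟩
          h                ≤⟨ m+n≤o⇒m≤o∸n h (2*power≤fℕ Δ 1≤e (2+e≤s+3e+2 e s)) ⟩
          fℕ Δ k ∸ h       ≤⟨ n≤1+n _ ⟩
          c                ∎
          where open ≤-Reasoning

        as≢bs : ∀ i j → as i ≢ bs j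
        as≢bs i j eq = n≮0 (subst (k <_) (d-refl (bs j)) (subst (λ x → k < d x (bs j)) eq (apart i j)))

        Label : Fin size → V → Set
        Label i u = as i ≡ u ⊎ bs i ≡ u

        Paired : V → Set
        Paired u = ∃ λ i → Label i u

        paired? : Decidable Paired
        paired? u = any? (λ i → (as i ≟ᶠ u) ⊎-dec (bs i ≟ᶠ u))

        label-unique : ∀ {i j u} → Label i u → Label j u → i ≡ j
        label-unique (inj₁ p) (inj₁ q) = as-inj (trans p (sym q))
        label-unique (inj₁ p) (inj₂ q) = contradiction (trans p (sym q)) (as≢bs _ _)
        label-unique (inj₂ p) (inj₁ q) = contradiction (trans q (sym p)) (as≢bs _ _)
        label-unique (inj₂ p) (inj₂ q) = bs-inj (trans p (sym q))

        φ₀ : V → Fin c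
        φ₀ u with paired? u
        ... | yes (i , _) = inject≤ i size≤c
        -- An arbitrary value: the greedy pass recolours every unpaired vertex.
        ... | no  _       = zeroᶠ

        φ₀-label : ∀ {i u} → Label i u → φ₀ u ≡ inject≤ i size≤c
        φ₀-label {i} {u} l with paired? u
        ... | yes (j , l′) = cong (λ x → inject≤ x size≤c) (label-unique l′ l)
        ... | no  ¬l       = contradiction (i , l) ¬l

        -- Equal colours mean the same pair, and the two members of a pair are too far apart to be
        -- adjacent.
        φ₀-proper : ∀ u w → Paired u → Paired w → Near k u w → φ₀ u ≢ φ₀ w
        φ₀-proper u w (i , lu) (j , lw) (w≢u , duw≤k) eq = clash lu (subst (λ x → Label x w) (sym i≡j) lw)
          where
          i≡j : i ≡ j
          i≡j = inject≤-injective size≤c size≤c i j (trans (sym (φ₀-label lu)) (trans eq (φ₀-label lw)))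
          clash : Label i u → Label i w → _
          clash (inj₁ refl) (inj₁ refl) = w≢u refl
          clash (inj₁ refl) (inj₂ refl) = <⇒≱ (apart i i) duw≤k
          clash (inj₂ refl) (inj₁ refl) = <⇒≱ (apart i i) (subst (_≤ k) (d-sym u w) duw≤k)
          clash (inj₂ refl) (inj₂ refl) = w≢u refl

        later? : ∀ x → Decidable (λ u → Near k x u × ρ u < ρ x)
        later? x u = near? k x u ×-dec (ρ u <? ρ x)

        -- Take p at distance e + 3 from x towards r: the levels e, e + 1, e + 2 above
        -- p are still closer to r than x.  Three levels are used because 2h of these
        -- vertices may be precoloured; one level would not suffice for Δ = 2.
        count-later : ∀ x → e + 3 ≤ ρ x → FullUpTo x → h + h + h ≤ count (later? x)
        count-later x far full with m≤n⇒∃[o]m+o≡n far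
        ... | l , e+3+l≡ρx with between (suc (e + 2)) {l}
               (trans (d-sym x r) (trans (sym e+3+l≡ρx) (cong (_+ l) (+-suc e 2))))
        ... | p , dp , dpr = begin
          h + h + h                                            ≤⟨ +-mono-≤ (+-mono-≤ (h≤ 0 z≤n) (h≤ 1 (s≤s z≤n))) (h≤ 2 ≤-refl) ⟩
          count (A? 0) + count (A? 1) + count (A? 2)           ≤⟨ +-monoˡ-≤ (count (A? 2)) (count-disjoint (A? 0) (A? 1) A01? (distinct λ ()) inj₁ inj₂) ⟩
          count A01? + count (A? 2)                            ≤⟨ count-disjoint A01? (A? 2) (later? x) distinct₂ later₂ (later 2 ≤-refl) ⟩
          count (later? x)                                     ∎
          where
          open ≤-Reasoning
          A? : ∀ t → Decidable (Above dp (t + e))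
          A? t = above? dp (t + e)
          A01? : Decidable (λ u → Above dp (0 + e) u ⊎ Above dp (1 + e) u)
          A01? u = A? 0 u ⊎-dec A? 1 u

          -- The chosen level has distance `t + 2 * e + 3` from `x`, which must not exceed `k - e`;
          -- for this `3 ≤ s` suffices.
          fits : ∀ t → t ≤ 2 → suc (t + e + (e + 2)) + e ≤ k
          fits t t≤2 = begin
            suc (t + e + (e + 2)) + e  ≤⟨ +-monoˡ-≤ e (s≤s (+-monoˡ-≤ (e + 2) (+-monoˡ-≤ e t≤2))) ⟩
            suc (2 + e + (e + 2)) + e  ≡⟨ lemma e ⟩
            3 + (3 * e + 2)            ≤⟨ +-monoˡ-≤ (3 * e + 2) (≤-trans (m≤n+m 3 (5 * e)) 5e+3≤s) ⟩
            k                          ∎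
            where
            lemma : ∀ e → suc (2 + e + (e + 2)) + e ≡ 3 + (3 * e + 2)
            lemma = solve-∀

          h≤ : ∀ t → t ≤ 2 → h ≤ count (A? t)
          h≤ t t≤2 = ≤-trans (^-monoʳ-≤-pos b 1≤e (m≤n+m e t)) (above≥ dp (full _ (fits t t≤2)))

          distinct : ∀ {t t′ u} → t ≢ t′ → Above dp (t + e) u → ¬ Above dp (t′ + e) u
          distinct {t} {t′} t≢t′ (du , _) (du′ , _) =
            t≢t′ (+-cancelʳ-≡ e t t′ (+-cancelʳ-≡ (e + 2) _ _ (suc-injective (trans (sym du) du′))))

          distinct₂ : ∀ {u} → Above dp (0 + e) u ⊎ Above dp (1 + e) u → ¬ Above dp (2 + e) u
          distinct₂ (inj₁ A) = distinct {0} {2} (λ ()) A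
          distinct₂ (inj₂ A) = distinct {1} {2} (λ ()) A

          later : ∀ t → t ≤ 2 → ∀ {u} → Above dp (t + e) u → Near k x u × ρ u < ρ x
          later t t≤2 {u} (du , dpu) = (u≢x , ≤-trans (≤-reflexive du) (≤-trans (m≤m+n _ e) (fits t t≤2))) , closer
            where
            u≢x : u ≢ x
            u≢x refl = contradiction (trans (sym (d-refl u)) du) λ ()
            closer : ρ u < ρ x
            closer = begin-strict
              d r u              ≤⟨ d-triangle r p u ⟩
              d r p + d p u      ≤⟨ +-mono-≤ (≤-reflexive (trans (d-sym r p) dpr)) (≤-trans dpu (+-monoˡ-≤ e t≤2)) ⟩
              l + (2 + e)        <⟨ ≤-reflexive (lemma l e) ⟩
              e + 3 + l          ≡⟨ e+3+l≡ρx ⟩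
              ρ x                ∎
              where
              lemma : ∀ l e → suc (l + (2 + e)) ≡ e + 3 + l
              lemma = solve-∀

          later₂ : ∀ {u} → Above dp (0 + e) u ⊎ Above dp (1 + e) u → Near k x u × ρ u < ρ x
          later₂ (inj₁ A) = later 0 z≤n A
          later₂ (inj₂ A) = later 1 (s≤s z≤n) A

        -- The greedy requirement at a single vertex. As `L` lists colours and not vertices,
        -- neighbours coloured alike by `φ` are charged once.
        Seen : (V → Fin c) → V → Set
        Seen φ x = ∃ λ (L : List (Fin c)) → length L < c × (∀ u → Near k x u → Paired u ⊎ ρ x ≤ ρ u → φ u ∈ L)

        -- `T` is a set of representatives for the colours at the relevant neighbours, so its size
        -- bounds the number of forbidden colours.
        seen-by : ∀ φ x {T : Pred V 0ℓ} (T? : Decidable T) → count T? + h ≤ fℕ Δ k →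
                  (∀ u → Near k x u → Paired u ⊎ ρ x ≤ ρ u → ∃ λ w → T w × φ u ≡ φ w) → Seen φ x
        seen-by φ x {T} T? T+h≤fℕ represent =
          map φ (members T?) ,
          s≤s (≤-trans (≤-reflexive (length-map φ (members T?))) (m+n≤o⇒m≤o∸n _ T+h≤fℕ)) ,
          λ u x~u early → listed (represent u x~u early)
          where
          listed : ∀ {u} → (∃ λ w → T w × φ u ≡ φ w) → φ u ∈ map φ (members T?)
          listed (w , Tw , eq) = subst (_∈ map φ (members T?)) (sym eq) (∈-map⁺ φ (∈-members T? Tw))

        -- Of the `3h` neighbours closer to `r`, at most `2h` are paired; the other `h` are still
        -- uncoloured when `x` is treated.
        few-far : ∀ φ x → e + 3 ≤ ρ x → FullUpTo x → Seen φ x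
        few-far φ x far full = seen-by φ x early? early+h≤fℕ (λ u x~u early → u , (x~u , early) , refl)
          where
          open ≤-Reasoning
          early? : Decidable (λ u → Near k x u × (Paired u ⊎ ρ x ≤ ρ u))
          early? u = near? k x u ×-dec (paired? u ⊎-dec (ρ x ≤? ρ u))
          free? : Decidable (λ u → (Near k x u × ρ u < ρ x) × ¬ Paired u)
          free? u = later? x u ×-dec ¬? (paired? u)
          as? bs? : Decidable _
          as? u = any? (λ i → as i ≟ᶠ u)
          bs? u = any? (λ i → bs i ≟ᶠ u)

          sort-later : ∀ {u} → Near k x u × ρ u < ρ x → ((Near k x u × ρ u < ρ x) × ¬ Paired u) ⊎ Paired u
          sort-later {u} l with paired? u
          ... | yes p = inj₂ p
          ... | no ¬p = inj₁ (l , ¬p)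

          sort-pair : ∀ {u} → Paired u → (∃ λ i → as i ≡ u) ⊎ (∃ λ i → bs i ≡ u)
          sort-pair (i , inj₁ p) = inj₁ (i , p)
          sort-pair (i , inj₂ p) = inj₂ (i , p)

          h≤free : h ≤ count free?
          h≤free = +-cancelʳ-≤ (h + h) h (count free?) (begin
            h + (h + h)                            ≡⟨ +-assoc h h h ⟨
            h + h + h                              ≤⟨ count-later x far full ⟩
            count (later? x)                       ≤⟨ count-cover free? paired? (later? x) sort-later ⟩
            count free? + count paired?            ≤⟨ +-monoʳ-≤ (count free?) (count-cover as? bs? paired? sort-pair) ⟩
            count free? + (count as? + count bs?)  ≤⟨ +-monoʳ-≤ (count free?) (+-mono-≤
                                                        (≤-trans (count-image≤ as? as id) size≤h)
                                                        (≤-trans (count-image≤ bs? bs id) size≤h)) ⟩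
            count free? + (h + h)                  ∎)

          early+h≤fℕ : count early? + h ≤ fℕ Δ k
          early+h≤fℕ = begin
            count early? + h            ≤⟨ +-monoʳ-≤ (count early?) h≤free ⟩
            count early? + count free?  ≤⟨ count-disjoint early? free? (near? k x) exclusive proj₁ (proj₁ ∘ proj₁) ⟩
            count (near? k x)           ≤⟨ count-near≤fℕ k x ⟩
            fℕ Δ k                      ∎
            where
            exclusive : ∀ {u} → Near k x u × (Paired u ⊎ ρ x ≤ ρ u) → ¬ ((Near k x u × ρ u < ρ x) × ¬ Paired u)
            exclusive (_ , inj₁ p)  (_ , ¬p)       = ¬p p
            exclusive (_ , inj₂ ≤ρ) ((_ , <ρ) , _) = <⇒≱ <ρ ≤ρ

        -- Both members of at least `h` pairs are neighbours of `x`. Each `bs i` is represented by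
        -- `as i`, which has the same colour, so `h` neighbours drop out.
        few-close : ∀ φ → (∀ u → Paired u → φ u ≡ φ₀ u) → ∀ x → ¬ Paired x → ρ x ≤ e + 2 → FullUpTo x → Seen φ x
        few-close φ agree x ¬px close full = seen-by φ x rest? rest+h≤fℕ represent
          where
          open ≤-Reasoning
          h≤size = proj₁ (seen x close full)
          sees-a = proj₁ (proj₂ (seen x close full))
          sees-b = proj₂ (proj₂ (seen x close full))

          second? : Decidable (λ u → ∃ λ i → bs i ≡ u)
          second? u = any? (λ i → bs i ≟ᶠ u)
          rest? : Decidable (λ u → Near k x u × ¬ (∃ λ i → bs i ≡ u))
          rest? u = near? k x u ×-dec ¬? (second? u)

          second⇒near : ∀ {u} → (∃ λ i → bs i ≡ u) → Near k x u
          second⇒near (i , refl) = (λ { refl → ¬px (i , inj₂ refl) }) , sees-b i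

          rest+h≤fℕ : count rest? + h ≤ fℕ Δ k
          rest+h≤fℕ = begin
            count rest? + h              ≤⟨ +-monoʳ-≤ (count rest?) (≤-trans h≤size (injection⇒≤count second? bs bs-inj (λ i → i , refl))) ⟩
            count rest? + count second?  ≤⟨ count-disjoint rest? second? (near? k x) proj₂ proj₁ second⇒near ⟩
            count (near? k x)            ≤⟨ count-near≤fℕ k x ⟩
            fℕ Δ k                       ∎

          represent : ∀ u → Near k x u → Paired u ⊎ ρ x ≤ ρ u →
                      ∃ λ w → (Near k x w × ¬ (∃ λ i → bs i ≡ w)) × φ u ≡ φ w
          represent u x~u _ with second? u
          ... | no  ¬b         = u , (x~u , ¬b) , refl
          ... | yes (i , refl) = as i ,
            (((λ { refl → ¬px (i , inj₁ refl) }) , sees-a i) , (λ (j , eq) → as≢bs i j (sym eq))) ,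
            trans (agree (bs i) (i , inj₂ refl)) (trans (φ₀-label (inj₂ refl))
              (sym (trans (agree (as i) (i , inj₁ refl)) (φ₀-label (inj₁ refl)))))

        -- The three sources of the saving: a deficient sphere, neighbours coloured later, or
        -- repeated colours.
        few : ∀ φ → (∀ u → Paired u → φ u ≡ φ₀ u) → ∀ x → ¬ Paired x → Seen φ x
        few φ agree x ¬px with full-or-loss x
        ... | inj₂ loss = seen-by φ x (near? k x) loss (λ u x~u _ → u , x~u , refl)
        ... | inj₁ full with e + 3 ≤? ρ x
        ... | yes far  = few-far φ x far full
        ... | no  ¬far = few-close φ agree x ¬px (s≤s⁻¹ (subst (ρ x <_) (+-suc e 2) (≰⇒> ¬far))) full

      pairing⇒colouring : ∃ λ (φ : V → Fin c) → ∀ u w → Near k u w → φ u ≢ φ w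
      pairing⇒colouring = Greedy.greedy (Near k) Near-sym (λ (v≢v , _) → v≢v refl)
        paired? φ₀ φ₀-proper ρ few

    -- Pairs at the two ends of a long geodesic.

    module _ {a r z : V} (dar : d a r ≡ s) (drz : d r z ≡ s) (daz : d a z ≡ s + s) where

      private
        ball? : ∀ y → Decidable (λ u → d y u ≤ e)
        ball? y u = d y u ≤? e

        -- The descendants of `y` after `e` steps, in the layering from `v`, lie in the ball. Their
        -- distance from `v` is at most `s + 2 * e + 2`, which is `k - e`. The case `v = y` is
        -- excluded by `e + 2 < s`.
        full⇒ball : ∀ {v y} → d r y ≡ s → d r v ≤ e + 2 → FullUpTo v → h ≤ count (ball? y)
        full⇒ball {v} {y} dry close full with d v y in dvy
        ... | zero = contradiction (begin-strict
                e + 2      <⟨ +-monoʳ-< e (n<1+n 2) ⟩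
                e + 3      ≤⟨ +-monoˡ-≤ 3 (m≤m+n e _) ⟩
                5 * e + 3  ≤⟨ 5e+3≤s ⟩
                s          ≡⟨ dry ⟨
                d r y      ≡⟨ cong (d r) (d≡0⇒≡ dvy) ⟨
                d r v      ≤⟨ close ⟩
                e + 2      ∎) (<-irrefl refl)
          where open ≤-Reasoning
        ... | suc j = ≤-trans (above≥ dvy (full (e + j) fits)) (count-mono (above? dvy e) (ball? y) proj₂)
          where
          open ≤-Reasoning
          fits : suc (e + j) + e ≤ k
          fits = begin
            suc (e + j) + e            ≡⟨ shuffle₁ e j ⟩
            suc j + 2 * e              ≡⟨ cong (_+ 2 * e) dvy ⟨
            d v y + 2 * e              ≤⟨ +-monoˡ-≤ (2 * e) (d-triangle v r y) ⟩
            d v r + d r y + 2 * e      ≤⟨ +-monoˡ-≤ (2 * e) (+-mono-≤ (≤-trans (≤-reflexive (d-sym v r)) close) (≤-reflexive dry)) ⟩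
            e + 2 + s + 2 * e          ≡⟨ shuffle₂ e s ⟩
            k                          ∎
            where
            shuffle₁ : ∀ e j → suc (e + j) + e ≡ suc j + 2 * e
            shuffle₁ = solve-∀
            shuffle₂ : ∀ e s → e + 2 + s + 2 * e ≡ s + (3 * e + 2)
            shuffle₂ = solve-∀

        ball-seen : ∀ {v y u} → d r y ≡ s → d r v ≤ e + 2 → d y u ≤ e → d v u ≤ k
        ball-seen {v} {y} {u} dry close dyu = begin
          d v u                    ≤⟨ d-triangle v r u ⟩
          d v r + d r u            ≤⟨ +-monoʳ-≤ (d v r) (d-triangle r y u) ⟩
          d v r + (d r y + d y u)  ≤⟨ +-mono-≤ (≤-trans (≤-reflexive (d-sym v r)) close) (+-mono-≤ (≤-reflexive dry) dyu) ⟩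
          e + 2 + (s + e)          ≤⟨ m≤n+m _ e ⟩
          e + (e + 2 + (s + e))    ≡⟨ shuffle e s ⟩
          k                        ∎
          where
          open ≤-Reasoning
          shuffle : ∀ e s → e + (e + 2 + (s + e)) ≡ s + (3 * e + 2)
          shuffle = solve-∀

        -- The condition `5 * e + 3 ≤ s` is tailored to this: it amounts to `k + 2 * e < 2 * s`.
        balls-apart : ∀ {x y} → d a x ≤ e → d z y ≤ e → k < d x y
        balls-apart {x} {y} dax dzy = +-cancelʳ-≤ (2 * e) (suc k) (d x y) (begin
          suc k + 2 * e            ≡⟨ shuffle₁ s e ⟩
          s + (5 * e + 3)          ≤⟨ +-monoʳ-≤ s 5e+3≤s ⟩
          s + s                    ≡⟨ daz ⟨
          d a z                    ≤⟨ d-triangle a x z ⟩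
          d a x + d x z            ≤⟨ +-monoʳ-≤ (d a x) (d-triangle x y z) ⟩
          d a x + (d x y + d y z)  ≤⟨ +-mono-≤ dax (+-monoʳ-≤ (d x y) (≤-trans (≤-reflexive (d-sym y z)) dzy)) ⟩
          e + (d x y + e)          ≡⟨ shuffle₂ e (d x y) ⟩
          d x y + 2 * e            ∎)
          where
          open ≤-Reasoning
          shuffle₁ : ∀ s e → suc (s + (3 * e + 2)) + 2 * e ≡ s + (5 * e + 3)
          shuffle₁ = solve-∀
          shuffle₂ : ∀ e x → e + (x + e) ≡ x + 2 * e
          shuffle₂ = solve-∀

        dra : d r a ≡ s
        dra = trans (d-sym r a) dar

        -- If a ball of radius e around a or z is small, no vertex near r is full up
        -- to the required level, so no pairs are needed.
        no-pairs : (∀ v → d r v ≤ e + 2 → ¬ FullUpTo v) → Pairing r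
        no-pairs ¬full = record
          { size = 0 ; size≤h = z≤n ; as = λ () ; bs = λ ()
          ; as-inj = λ { {()} } ; bs-inj = λ { {()} } ; apart = λ ()
          ; seen = λ v close full → contradiction full (¬full v close)
          }

        pairs : h ≤ count (ball? a) → h ≤ count (ball? z) → Pairing r
        pairs pa pz =
          let as , as-inj , as∈ = ≤count⇒injection (ball? a) pa
              bs , bs-inj , bs∈ = ≤count⇒injection (ball? z) pz
          in record
          { size = h ; size≤h = ≤-refl ; as = as ; bs = bs ; as-inj = as-inj ; bs-inj = bs-inj
          ; apart = λ i j → balls-apart (as∈ i) (bs∈ j)
          ; seen = λ v close _ → ≤-refl , (λ i → ball-seen dra close (as∈ i)) , (λ i → ball-seen drz close (bs∈ i))
          }

        choose : Dec (h ≤ count (ball? a)) → Dec (h ≤ count (ball? z)) → Pairing r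
        choose (no ¬a)  _        = no-pairs λ v close full → ¬a (full⇒ball dra close full)
        choose (yes _)  (no ¬z)  = no-pairs λ v close full → ¬z (full⇒ball drz close full)
        choose (yes pa) (yes pz) = pairs pa pz

      pairing : Pairing r
      pairing = choose (h ≤? count (ball? a)) (h ≤? count (ball? z))

    large⇒colouring : V → suc (fℕ Δ (s + s)) < order G →
      ∃ λ (φ : V → Fin (suc (fℕ Δ k ∸ h))) → ∀ u w → Near k u w → φ u ≢ φ w
    large⇒colouring v large =
      let a , r , z , dar , drz , daz = geodesic-centre s v large
      in pairing⇒colouring (pairing dar drz daz)

-- Finiteness of the set of graphs of bounded order.

indicator : ∀ {P : Set} → Dec P → Fin 2
indicator (yes _) = sucᶠ zeroᶠ
indicator (no _)  = zeroᶠ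

indicator⁺ : ∀ {P : Set} (P? : Dec P) → P → indicator P? ≡ sucᶠ zeroᶠ
indicator⁺ (yes _) _ = refl
indicator⁺ (no ¬p) p = contradiction p ¬p

indicator⁻ : ∀ {P : Set} (P? : Dec P) → indicator P? ≡ sucᶠ zeroᶠ → P
indicator⁻ (yes p) _ = p

module _ (n : ℕ) where

  bit : Fin ((2 ^ n) ^ n) → Fin n → Fin n → Fin 2
  bit i u v = finToFun (finToFun i u) v

  -- A code is an arbitrary 0-1 matrix. Asking for both entries off the diagonal makes every code a
  -- graph and changes nothing for an adjacency matrix.
  decode : Fin ((2 ^ n) ^ n) → Graph
  decode i = record
    { order  = n
    ; Adj    = λ u v → u ≢ v × bit i u v ≡ sucᶠ zeroᶠ × bit i v u ≡ sucᶠ zeroᶠ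
    ; adj?   = λ u v → ¬? (u ≟ᶠ v) ×-dec (bit i u v ≟ᶠ _) ×-dec (bit i v u ≟ᶠ _)
    ; symm   = λ (u≢v , p , q) → u≢v ∘ sym , q , p
    ; irrefl = λ (v≢v , _) → v≢v refl
    }

module _ (G : Graph) where
  open Graph G using (Adj; adj?; symm; irrefl)

  encode : Fin ((2 ^ order G) ^ order G)
  encode = funToFin (λ u → funToFin (λ v → indicator (adj? u v)))

  bit-encode : ∀ u v → bit (order G) encode u v ≡ indicator (adj? u v)
  bit-encode u v = trans (cong (λ i → finToFun i v) (finToFun-funToFin (λ u → funToFin (λ v → indicator (adj? u v))) u))
                         (finToFun-funToFin (λ v → indicator (adj? u v)) v)

  ≅-decode-encode : G ≅ decode (order G) encode
  ≅-decode-encode = record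
    { bijection = ↔-id _
    ; adjacency = λ u v → mk⇔
        (λ a → (λ { refl → irrefl a }) ,
               trans (bit-encode u v) (indicator⁺ (adj? u v) a) ,
               trans (bit-encode v u) (indicator⁺ (adj? v u) (symm a)))
        (λ (_ , p , _) → indicator⁻ (adj? u v) (trans (sym (bit-encode u v)) p))
    }

graphsUpTo : ℕ → List Graph
graphsUpTo N = concatMap (λ n → map (decode n) (allFin ((2 ^ n) ^ n))) (upTo (suc N))

bounded-order⇒finitelyMany : ∀ N (G : Graph) → order G ≤ N → Any (G ≅_) (graphsUpTo N)
bounded-order⇒finitelyMany N G n≤N = lose
  (∈-concatMap⁺ (λ n → map (decode n) (allFin ((2 ^ n) ^ n)))
    (lose (∈-upTo⁺ (s≤s n≤N)) (∈-map⁺ (decode (order G)) (∈-allFin (encode G)))))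
  (≅-decode-encode G)

-- From natural numbers to the integer-valued gap.

fℕ-zero : ∀ k → fℕ 0 k ≡ 0
fℕ-zero zero    = refl
fℕ-zero (suc k) = trans (+-identityʳ (fℕ 0 k)) (fℕ-zero k)

pos-^ : ∀ b k → (+ b) ℤ.^ k ≡ + (b ^ k)
pos-^ b zero    = refl
pos-^ b (suc k) = trans (cong (+ b ℤ.*_) (pos-^ b k)) (sym (ℤ.pos-* b (b ^ k)))

sumℤ : (ℕ → ℤ) → ℕ → ℤ
sumℤ g k = foldr ℤ._+_ 0ℤ (applyUpTo g k)

-- The fold splits off the first term of the sum, whereas `fℕ` splits off the last.
sumℤ-suc : ∀ g k → sumℤ g (suc k) ≡ sumℤ g k ℤ.+ g k
sumℤ-suc g zero    = ℤ.+-comm (g 0) 0ℤ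
sumℤ-suc g (suc k) = trans (cong (λ x → g 0 ℤ.+ x) (sumℤ-suc (g ∘ suc) k)) (sym (ℤ.+-assoc (g 0) _ _))

f≡fℕ : ∀ k Δ → f k (+ Δ) ≡ + fℕ Δ k
-- At degree 0 the bases differ, -1 in `f` and 0 in `fℕ`, but the factor 0 in front annihilates
-- both.
f≡fℕ k zero = trans (ℤ.*-zeroˡ (sumℤ (λ i → (0ℤ ℤ.- 1ℤ) ℤ.^ i) k)) (cong +_ (sym (fℕ-zero k)))
f≡fℕ zero (suc b) = ℤ.*-zeroʳ (+ suc b)
f≡fℕ (suc k) (suc b) = begin
  + suc b ℤ.* sumℤ ((+ b) ℤ.^_) (suc k)
    ≡⟨ cong (+ suc b ℤ.*_) (sumℤ-suc ((+ b) ℤ.^_) k) ⟩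
  + suc b ℤ.* (sumℤ ((+ b) ℤ.^_) k ℤ.+ (+ b) ℤ.^ k)
    ≡⟨ ℤ.*-distribˡ-+ (+ suc b) (sumℤ ((+ b) ℤ.^_) k) ((+ b) ℤ.^ k) ⟩
  f k (+ suc b) ℤ.+ + suc b ℤ.* (+ b) ℤ.^ k
    ≡⟨ cong₂ ℤ._+_ (f≡fℕ k (suc b)) (trans (cong (+ suc b ℤ.*_) (pos-^ b k)) (sym (ℤ.pos-* (suc b) (b ^ k)))) ⟩
  + fℕ (suc b) (suc k) ∎
  where open ≡-Reasoning

colourable⇒gap : ∀ k G h → h ≤ fℕ (maxDegree G) k →
                 Colourable (power G k) (suc (fℕ (maxDegree G) k ∸ h)) → + h ≤ℤ gap k G
colourable⇒gap k G h h≤fℕ colourable = begin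
  + h                            ≡⟨ ℤ.+-identityʳ (+ h) ⟨
  + h ℤ.+ 0ℤ                     ≡⟨ cong (λ x → + h ℤ.+ x) (ℤ.+-inverseʳ (+ c)) ⟨
  + h ℤ.+ (+ c -ℤ + c)           ≡⟨ ℤ.+-assoc (+ h) (+ c) (ℤ.- + c) ⟨
  + (h + c) -ℤ + c               ≤⟨ ℤ.+-monoˡ-≤ (ℤ.- + c) (ℤ.+≤+ h+c≤) ⟩
  + (fℕ Δ k + 1) -ℤ + c          ≡⟨ cong (λ x → x ℤ.+ 1ℤ -ℤ + c) (f≡fℕ k Δ) ⟨
  gap k G                        ∎
  where
  open ℤ.≤-Reasoning
  Δ = maxDegree G
  c = χ (power G k)
  h+c≤ : h + c ≤ fℕ Δ k + 1
  h+c≤ = ≤-trans (+-monoʳ-≤ h (proj₂ (proj₂ (χ-least (power G k))) _ colourable))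
    (≤-reflexive (trans (+-suc h _) (trans (cong suc (m+[n∸m]≡n h≤fℕ)) (+-comm 1 _))))

-- Choice of the exponent and the lower bound on the gap.

-- Rounding up ensures `k < 12 * e`, as the lower growth bound demands; in the upper bound it costs
-- only a constant factor.
exponent : ℕ → ℕ
exponent k = suc (k / 12)

-- From k = 48 on, 8 * exponent k + 5 ≤ k; below, the greedy bound suffices.
saving : ℕ → ℕ → ℕ
saving Δ k with 48 ≤? k
... | yes _ = (Δ ∸ 1) ^ exponent k
... | no  _ = 0

4≤k/12 : ∀ {k} → 48 ≤ k → 4 ≤ k / 12
4≤k/12 48≤k = /-monoˡ-≤ 12 48≤k

-- This is `5 * e + 3 ≤ s` for `k = s + (3 * e + 2)`. With `e = q + 1` the left side is
-- `8 * q + 13`, and `13 ≤ 4 * q` holds from `q = 4` on, hence the threshold 48.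
exponent-small : ∀ {k} → 48 ≤ k → 8 * exponent k + 5 ≤ k
exponent-small {k} 48≤k = begin
  8 * suc q + 5         ≡⟨ shuffle₁ q ⟩
  8 * q + 13            ≤⟨ +-monoʳ-≤ (8 * q) (m≤n+m 13 3) ⟩
  8 * q + 4 * 4         ≤⟨ +-monoʳ-≤ (8 * q) (*-monoʳ-≤ 4 (4≤k/12 48≤k)) ⟩
  8 * q + 4 * q         ≡⟨ shuffle₂ q ⟩
  q * 12                ≤⟨ m/n*n≤m k 12 ⟩
  k                     ∎
  where
  open ≤-Reasoning
  q = k / 12
  shuffle₁ : ∀ q → 8 * suc q + 5 ≡ 8 * q + 13
  shuffle₁ = solve-∀
  shuffle₂ : ∀ q → 8 * q + 4 * q ≡ q * 12
  shuffle₂ = solve-∀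

module _ (G : Graph) (walks : ∀ u v → ∃ (Walk G u v)) where

  private
    Δ = maxDegree G

    d : Vertex G → Vertex G → ℕ
    d u v = proj₁ (least (walk? G u v) (walks u v))

    d-isDistance : ∀ u v → IsDistance G u v (d u v)
    d-isDistance u v = proj₂ (least (walk? G u v) (walks u v))

    open Metric G (degree≤maxDegree G) d d-isDistance using (Near)

    power⇒near : ∀ {k u v} → PowerAdj G k u v → Near k u v
    power⇒near {k} {u} {v} (u≢v , m , m≤k , walk , _) = u≢v ∘ sym , ≤-trans (proj₂ (d-isDistance u v) m walk) m≤k

    near⇒colourable : ∀ {k c} → (∃ λ (φ : Vertex G → Fin c) → ∀ u w → Near k u w → φ u ≢ φ w) →
                      Colourable (power G k) c
    near⇒colourable (φ , proper) = φ , λ u w a → proper u w (power⇒near a)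

  gap≥0 : ∀ k → 0ℤ ≤ℤ gap k G
  gap≥0 k = colourable⇒gap k G 0 z≤n
    (near⇒colourable (near-colourable G (degree≤maxDegree G) d d-isDistance k))

  gap≥power : ∀ {e s} → 1 ≤ e → 5 * e + 3 ≤ s → suc (fℕ Δ (s + s)) < order G →
              + ((Δ ∸ 1) ^ e) ≤ℤ gap (s + (3 * e + 2)) G
  gap≥power {e} {s} 1≤e 5e+3≤s large = colourable⇒gap _ G _
    (≤-trans (m≤m+n _ _) (2*power≤fℕ Δ 1≤e (2+e≤s+3e+2 e s)))
    (near⇒colourable (Core.large⇒colouring G (degree≤maxDegree G) d d-isDistance 1≤e 5e+3≤s
      (fromℕ< (≤-<-trans z≤n large)) large))

-- The bound `N` is the order beyond which a geodesic of length `2 * s` must exist; `s` depends on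
-- `k` only. For small `k` a nonnegative gap is enough.
gap≥saving : ∀ Δ k → ∃ λ N → ∀ G → Connected G → maxDegree G ≡ Δ → N < order G → + saving Δ k ≤ℤ gap k G
gap≥saving Δ k with 48 ≤? k
... | no  _    = 0 , λ G (_ , walks) _ _ → gap≥0 G walks k
... | yes 48≤k = suc (fℕ Δ (s + s)) , bound
  where
  e = exponent k
  s = k ∸ (3 * e + 2)

  split-8 : ∀ e → 5 * e + 3 + (3 * e + 2) ≡ 8 * e + 5
  split-8 = solve-∀

  8e+5≤k : 5 * e + 3 + (3 * e + 2) ≤ k
  8e+5≤k = ≤-trans (≤-reflexive (split-8 e)) (exponent-small 48≤k)

  bound : ∀ G → Connected G → maxDegree G ≡ Δ → suc (fℕ Δ (s + s)) < order G → + ((Δ ∸ 1) ^ e) ≤ℤ gap k G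
  bound G (_ , walks) refl large = subst (λ m → + ((Δ ∸ 1) ^ e) ≤ℤ gap m G)
    (m∸n+n≡m (m+n≤o⇒n≤o (5 * e + 3) 8e+5≤k))
    (gap≥power G walks {e} {s} (s≤s z≤n) (m+n≤o⇒m≤o∸n (5 * e + 3) 8e+5≤k) large)

-- Transfer to the rationals and the growth rate.

toℚᵘ-fromℤ : ∀ i → ℚ.toℚᵘ (fromℤ i) ℚᵘ.≃ mkℚᵘ i 0
toℚᵘ-fromℤ i = ℚ.toℚᵘ-fromℚᵘ (mkℚᵘ i 0)

fromℤ-mono-≤ : ∀ {i j} → i ≤ℤ j → fromℤ i ℚ.≤ fromℤ j
fromℤ-mono-≤ {i} {j} i≤j = ℚ.toℚᵘ-cancel-≤ (begin
  ℚ.toℚᵘ (fromℤ i)  ≃⟨ toℚᵘ-fromℤ i ⟩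
  mkℚᵘ i 0          ≤⟨ ℚᵘ.*≤* (ℤ.*-monoʳ-≤-nonNeg 1ℤ i≤j) ⟩
  mkℚᵘ j 0          ≃⟨ toℚᵘ-fromℤ j ⟨
  ℚ.toℚᵘ (fromℤ j)  ∎)
  where open ℚᵘ.≤-Reasoning

fromℤ-* : ∀ i j → fromℤ i ℚ.* fromℤ j ≡ fromℤ (i ℤ.* j)
fromℤ-* i j = ℚ.toℚᵘ-injective (begin-equality
  ℚ.toℚᵘ (fromℤ i ℚ.* fromℤ j)              ≃⟨ ℚ.toℚᵘ-homo-* (fromℤ i) (fromℤ j) ⟩
  ℚ.toℚᵘ (fromℤ i) ℚᵘ.* ℚ.toℚᵘ (fromℤ j)    ≃⟨ ℚᵘ.*-cong (toℚᵘ-fromℤ i) (toℚᵘ-fromℤ j) ⟩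
  mkℚᵘ (i ℤ.* j) 0                          ≃⟨ toℚᵘ-fromℤ (i ℤ.* j) ⟨
  ℚ.toℚᵘ (fromℤ (i ℤ.* j))                  ∎)
  where open ℚᵘ.≤-Reasoning

fromℤ-^ : ∀ x n → fromℤ (+ x) ^ℚ n ≡ fromℤ (+ (x ^ n))
fromℤ-^ x zero    = refl
fromℤ-^ x (suc n) = trans (cong (fromℤ (+ x) ℚ.*_) (fromℤ-^ x n))
  (trans (fromℤ-* (+ x) (+ (x ^ n))) (cong fromℤ (sym (ℤ.pos-* x (x ^ n)))))

^*^-fromℤ : ∀ c n b k → (fromℤ (+ c) ^ℚ n) ℚ.* fromℤ ((+ b) ℤ.^ k) ≡ fromℤ (+ (c ^ n * b ^ k))
^*^-fromℤ c n b k = trans (cong₂ (λ x y → x ℚ.* fromℤ y) (fromℤ-^ c n) (pos-^ b k))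
  (trans (fromℤ-* (+ (c ^ n)) (+ (b ^ k))) (cong fromℤ (sym (ℤ.pos-* (c ^ n) (b ^ k)))))

Θ-fromℕ : ∀ b q (φ : ℕ → ℕ) c K →
  (∀ k → K ≤ k → b ^ k ≤ φ k ^ q × φ k ^ q ≤ suc c ^ q * b ^ k) →
  IsΘ-^[k/ q ] (+ b) (λ k → fromℤ (+ φ k))
Θ-fromℕ b q φ c K bounds = fromℤ 1ℤ , fromℤ (+ suc c) , positive 0 , positive c , K , λ k K≤k →
  let lower , upper = bounds k K≤k in
  fromℤ-mono-≤ {0ℤ} {+ φ k} (ℤ.+≤+ z≤n) ,
  subst₂ ℚ._≤_ (sym (^*^-fromℤ 1 q b k)) (sym (fromℤ-^ (φ k) q))
    (fromℤ-mono-≤ (ℤ.+≤+ (≤-trans (≤-reflexive (trans (cong (_* b ^ k) (^-zeroˡ q)) (*-identityˡ (b ^ k)))) lower))) ,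
  subst₂ ℚ._≤_ (sym (fromℤ-^ (φ k) q)) (sym (^*^-fromℤ (suc c) q b k)) (fromℤ-mono-≤ (ℤ.+≤+ upper))
  where
  positive : ∀ c → 0ℚ <ℚ fromℤ (+ suc c)
  positive c = ℚ.<-≤-trans (from-yes (0ℚ ℚ.<? 1ℚ)) (fromℤ-mono-≤ {1ℤ} {+ suc c} (ℤ.+≤+ (s≤s z≤n)))

saving-bounds : ∀ b k → 48 ≤ k → b ^ k ≤ saving (suc b) k ^ 12 × saving (suc b) k ^ 12 ≤ suc b ^ 12 * b ^ k
saving-bounds b k 48≤k with 48 ≤? k
... | no  k≱48 = contradiction 48≤k k≱48
... | yes _    =
  ≤-trans (^-monoʳ-≤-pos b (≤-trans (s≤s z≤n) 48≤k) k≤12e) (≤-reflexive (sym power12)) , (begin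
  (b ^ e) ^ 12             ≡⟨ power12 ⟩
  b ^ (12 + q * 12)        ≡⟨ ^-distribˡ-+-* b 12 (q * 12) ⟩
  -- The base `suc b` replaces `b` because the constant must be positive also for `b = 0`, that is,
  -- for maximum degree 1.
  b ^ 12 * b ^ (q * 12)    ≤⟨ *-mono-≤ (^-monoˡ-≤ 12 (n≤1+n b)) (^-monoʳ-≤-pos b 1≤12q (m/n*n≤m k 12)) ⟩
  suc b ^ 12 * b ^ k       ∎)
  where
  open ≤-Reasoning
  q = k / 12
  e = exponent k
  power12 : (b ^ e) ^ 12 ≡ b ^ (12 + q * 12)
  power12 = ^-*-assoc b e 12
  k≤12e : k ≤ 12 + q * 12
  k≤12e = ≤-trans (≤-reflexive (m≡m%n+[m/n]*n k 12)) (+-monoˡ-≤ (q * 12) (<⇒≤ (m%n<n k 12)))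
  1≤12q : 1 ≤ q * 12
  1≤12q = ≤-trans (s≤s z≤n) (*-monoˡ-≤ 12 (4≤k/12 48≤k))

theorem5 : ∃ λ (h : ℕ → ℤ → ℚ) →
    ((Δ : ℤ) → 1ℤ ≤ℤ Δ → IsΘ-^[k/ 12 ] (Δ -ℤ 1ℤ) (λ k → h k Δ)) ×
    ((Δ : ℤ) (k : ℕ) → FinitelyMany (λ G → Connected G × + maxDegree G ≡ Δ × fromℤ (gap k G) <ℚ h k Δ))
theorem5 = h , growth , finite
  where
  h : ℕ → ℤ → ℚ
  -- At negative `Δ` any value would do, as no maximum degree is negative.
  h k Δ = fromℤ (+ saving ∣ Δ ∣ k)

  growth : (Δ : ℤ) → 1ℤ ≤ℤ Δ → IsΘ-^[k/ 12 ] (Δ -ℤ 1ℤ) (λ k → h k Δ)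
  growth (+ suc b) _ = Θ-fromℕ b 12 (saving (suc b)) b 48 (saving-bounds b)
  growth (+ zero) (ℤ.+≤+ ())

  finite : (Δ : ℤ) (k : ℕ) → FinitelyMany (λ G → Connected G × + maxDegree G ≡ Δ × fromℤ (gap k G) <ℚ h k Δ)
  finite -[1+ _ ] k = [] , λ { G (_ , () , _) }
  finite (+ Δ) k = graphsUpTo N , λ G (connected , Δ≡ , gap<h) → bounded-order⇒finitelyMany N G
    -- An order above `N` would force the gap up to at least `h k Δ`.
    (≮⇒≥ λ N<n → ℚ.<-irrefl refl (ℚ.<-≤-trans gap<h (fromℤ-mono-≤ (proj₂ (gap≥saving Δ k) G connected (ℤ.+-injective Δ≡) N<n))))
    where N = proj₁ (gap≥saving Δ k)
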